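{- Let $3\le m\le n$ and let $c$ be an exact $(m+n+1)$-coloring of $[m]\times[n]$ such that $|c(D_m)|\le 3$. Then $[m]\times[n]$ contains a rainbow solution to $x_1+x_2=x_3$.
   Context: $[m]\times[n]=\{(i,j)\in\mathbb{Z}^2:1\le i\le m,1\le j\le n\}$ with componentwise addition. An $r$-coloring is a function $c:[m]\times[n]\to\{1,\dots,r\}$; exact means surjective. A rainbow solution to $x_1+x_2=x_3$ is a triple $\alpha,\beta,\gamma\in[m]\times[n]$ with $\alpha+\beta=\gamma$ and $c(\alpha),c(\beta),c(\gamma)$ pairwise distinct. For $k$ an integer, the $k$-th diagonal is $D_k=\{(i,j)\in[m]\times[n]: m-k=i-j\}$; $D_m=\{(i,i):1\le i\le m\}$ is the main diagonal. For $X\subseteq[m]\times[n]$, $c(X)=\{c(x):x\in X\}$. -}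

module Defs where

open import Data.Nat using (ℕ; _+_; _≤_; _<_)
open import Data.Product using (_×_; _,_; Σ; ∃; ∃-syntax)
open import Data.List using (List; length)
open import Data.List.Membership.Propositional using (_∈_)
open import Relation.Binary.PropositionalEquality using (_≡_; _≢_)

InGrid : ℕ → ℕ → ℕ → ℕ → Set
InGrid m n i j = (1 ≤ i × i ≤ m) × (1 ≤ j × j ≤ n)

-- A coloring is a function on pairs; only its values on the grid matter.
-- c is an r-coloring of [m]×[n]: every grid point gets a colour in {1,…,r}.
IsColoring : ℕ → ℕ → ℕ → (ℕ → ℕ → ℕ) → Set
IsColoring m n r c = ∀ i j → InGrid m n i j → 1 ≤ c i j × c i j ≤ r

IsExactColoring : ℕ → ℕ → ℕ → (ℕ → ℕ → ℕ) → Set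
IsExactColoring m n r c =
  IsColoring m n r c ×
  (∀ k → 1 ≤ k → k ≤ r → ∃[ i ] ∃[ j ] (InGrid m n i j × c i j ≡ k))

-- |c(D_m)| ≤ k : the colours on the main diagonal {(i,i) : 1 ≤ i ≤ m}
-- are all among some list of at most k colours.
DiagColorsAtMost : ℕ → (ℕ → ℕ → ℕ) → ℕ → Set
DiagColorsAtMost m c k =
  Σ (List ℕ) λ cs → length cs ≤ k × (∀ i → 1 ≤ i → i ≤ m → c i i ∈ cs)

RainbowSolution : ℕ → ℕ → (ℕ → ℕ → ℕ) → Set
RainbowSolution m n c =
  ∃[ a₁ ] ∃[ a₂ ] ∃[ b₁ ] ∃[ b₂ ]
    (InGrid m n a₁ a₂ × InGrid m n b₁ b₂ × InGrid m n (a₁ + b₁) (a₂ + b₂) ×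
     c a₁ a₂ ≢ c b₁ b₂ × c a₁ a₂ ≢ c (a₁ + b₁) (a₂ + b₂) ×
     c b₁ b₂ ≢ c (a₁ + b₁) (a₂ + b₂))

{-# OPTIONS --safe #-}

-- Suppose there is no rainbow solution. Two points of one diagonal differ by a
-- point (k , k), so off the main diagonal each diagonal has at most one colour not in
-- c(D_m). Since there are m + n - 2 such diagonals and m + n + 1 colours, each of
-- these diagonals has a colour of its own ("special" points) and D_m has exactly three.
--
-- If γ is special and β, γ - β are off the main diagonal, then c(β) = c(γ - β). Hence
-- the first special points of neighbouring diagonals are neighbours, and on the
-- diagonals with i > j (and likewise for i < j) they form a staircase from near the
-- main diagonal to the corner (m , 1). Two consecutive points of the staircase in one
-- column make the first column constant up to their row, and the colours in the first
-- column are those of the points (k , k) with k below the width of the staircase.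
--
-- Let (b , b) and (g , g) be the first occurrences of the second and third colour on D_m,
-- and (1 + x , x), (y , 1 + y) the first special points on the diagonals next to D_m. Then
-- |x - y| ≤ 1 and 2b ≤ g ≤ min(x , y) + 1, so b < x and b < y, and by the previous
-- paragraph each half of the staircase is straight. Its long straight part then makes
-- c(k , k) constant on 2 ≤ k < x = y, so g is x or 1 + x and
-- (1 , 1) + (g - 1 , g - 1) or (2 , 1) + (x - 1 , x) is a rainbow solution with sum (g , g).
module Submission where

open import Defs
open import Data.Empty using (⊥; ⊥-elim)
open import Data.Fin using (Fin; toℕ; fromℕ<; punchOut) renaming (_≟_ to _≟ᶠ_)
open import Data.Fin.Properties using (any?; punchOut-injective; injective⇒≤; toℕ-fromℕ<; toℕ-injective; toℕ<n)
open import Data.List using (List; _∷_; []; length)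
open import Data.List.Membership.Propositional using (_∈_)
open import Data.List.Relation.Unary.Any using (here; there)
open import Data.Nat using (ℕ; zero; suc; _+_; _≤_; _<_; z≤n; s≤s; s≤s⁻¹; _≟_; _≤?_)
open import Data.Nat.Properties
open import Data.Nat.Tactic.RingSolver using (solve)
open import Data.Product using (_×_; _,_; ∃; proj₁; proj₂)
open import Data.Sum using (_⊎_; inj₁; inj₂; map₂)
open import Function using (flip)
open import Relation.Binary.Definitions using (tri<; tri≈; tri>)
open import Relation.Binary.PropositionalEquality
open import Relation.Nullary using (¬_; Dec; yes; no; contradiction)
open import Relation.Nullary.Decidable using (_×-dec_; ¬?)
open import Relation.Unary using (Decidable)

-- Linear inequalities: the goal follows from the sum (_⊹_) of the hypotheses
-- by a semiring identity, in which k is the slack.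

infixl 5 _⊹_
_⊹_ : ∀ {a b c d} → a ≤ b → c ≤ d → a + c ≤ b + d
_⊹_ = +-mono-≤

≤-by : ∀ k {l r a b} → l ≤ r → a + r + k ≡ b + l → a ≤ b
≤-by k {l} {r} {a} {b} h e = +-cancelʳ-≤ r a b
  (≤-trans (m≤m+n (a + r) k) (≤-trans (≤-reflexive e) (+-monoʳ-≤ b h)))

≡-by : ∀ {l r a b} → l ≡ r → a + r ≡ b + l → a ≡ b
≡-by {l} {a = a} {b} refl e = +-cancelʳ-≡ l a b e

⊥-by : ∀ k {l r} → l ≤ r → r + suc k ≡ l → ⊥
⊥-by k {l} {r} h e = n≮n r (≤-trans (≤-trans (m<m+n r (s≤s z≤n)) (≤-reflexive e)) h)

≤⇒≡+ : ∀ {a b} → a ≤ b → ∃ λ k → b ≡ a + k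
≤⇒≡+ h = let k , e = m≤n⇒∃[o]m+o≡n h in k , sym e

1≤suc : ∀ {n} → 1 ≤ suc n
1≤suc = s≤s z≤n

-- Rainbow-free colourings and special points.

Coloring : Set
Coloring = ℕ → ℕ → ℕ

-- The sum enters through equations, so each use can take its coordinates in the form at hand.
NoRainbow : ℕ → ℕ → Coloring → Set
NoRainbow m n c = ∀ a₁ a₂ b₁ b₂ {s₁ s₂} → a₁ + b₁ ≡ s₁ → a₂ + b₂ ≡ s₂ →
  1 ≤ a₁ → 1 ≤ a₂ → 1 ≤ b₁ → 1 ≤ b₂ → s₁ ≤ m → s₂ ≤ n →
  c a₁ a₂ ≡ c b₁ b₂ ⊎ c a₁ a₂ ≡ c s₁ s₂ ⊎ c b₁ b₂ ≡ c s₁ s₂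

-- own says i′ - j′ = i - j, with both sides moved so that no subtraction occurs.
record Special (m n : ℕ) (c : Coloring) (i j : ℕ) : Set where
  constructor special
  field
    inGrid : InGrid m n i j
    off    : i ≢ j
    own    : ∀ i′ j′ → InGrid m n i′ j′ → c i′ j′ ≡ c i j → i′ + j ≡ i + j′

-- (d + x , x) is the first special point on its diagonal. An earlier point has
-- the colour of (k , k), where (k , k) is its difference to (d + x , x).
First : ℕ → ℕ → Coloring → ℕ → ℕ → Set
First m n c d x = Special m n c (d + x) x ×
  (∀ i k → 1 ≤ i → 1 ≤ k → i + k ≡ x → c (d + i) i ≡ c k k)

noRainbow-flip : ∀ {m n c} → NoRainbow m n c → NoRainbow n m (flip c)
noRainbow-flip nr a₁ a₂ b₁ b₂ e₁ e₂ p₁ p₂ q₁ q₂ h₁ h₂ =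
  nr a₂ a₁ b₂ b₁ e₂ e₁ p₂ p₁ q₂ q₁ h₂ h₁

special-flip : ∀ {m n c i j} → Special m n c i j → Special n m (flip c) j i
special-flip {i = i} {j} (special (gi , gj) off own) = special (gj , gi) (λ e → off (sym e))
  λ i′ j′ (hi , hj) e → trans (+-comm i′ i) (trans (sym (own j′ i′ (hj , hi) e)) (+-comm j′ j))

-- Sums that involve special points.

module _ {m n : ℕ} {c : Coloring} (nr : NoRainbow m n c) where

  -- A summand with the colour of the special sum would lie on the diagonal of the sum, which puts
  -- the other summand on the main diagonal.
  difference : ∀ a₁ a₂ b₁ b₂ {s₁ s₂} → Special m n c s₁ s₂ → a₁ + b₁ ≡ s₁ → a₂ + b₂ ≡ s₂ →
    1 ≤ a₁ → 1 ≤ a₂ → 1 ≤ b₁ → 1 ≤ b₂ → a₁ ≢ a₂ → b₁ ≢ b₂ → c a₁ a₂ ≡ c b₁ b₂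
  difference a₁ a₂ b₁ b₂ (special ((_ , h₁) , (_ , h₂)) off own) refl refl p₁ p₂ q₁ q₂ a≢ b≢
    with nr a₁ a₂ b₁ b₂ refl refl p₁ p₂ q₁ q₂ h₁ h₂
  ... | inj₁ e = e
  ... | inj₂ (inj₁ e) = ⊥-elim (b≢ (sym (≡-by (own a₁ a₂ ((p₁ , m+n≤o⇒m≤o a₁ h₁) , (p₂ , m+n≤o⇒m≤o a₂ h₂)) e)
          (solve (a₁ ∷ a₂ ∷ b₁ ∷ b₂ ∷ [])))))
  ... | inj₂ (inj₂ e) = ⊥-elim (a≢ (sym (≡-by (own b₁ b₂ ((q₁ , m+n≤o⇒n≤o a₁ h₁) , (q₂ , m+n≤o⇒n≤o a₂ h₂)) e)
          (solve (a₁ ∷ a₂ ∷ b₁ ∷ b₂ ∷ [])))))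

  -- A special point on the diagonal of offset d can lie below one of offset e
  -- only if e = d or e = 2 d.
  special-below : ∀ a₁ a₂ b₁ b₂ {s₁ s₂} → Special m n c a₁ a₂ → Special m n c s₁ s₂ →
    a₁ + b₁ ≡ s₁ → a₂ + b₂ ≡ s₂ → 1 ≤ b₁ → 1 ≤ b₂ → b₁ ≢ b₂ →
    c b₁ b₂ ≡ c a₁ a₂ × b₁ + a₂ ≡ a₁ + b₂
  special-below a₁ a₂ b₁ b₂ (special ((p₁ , _) , (p₂ , _)) off own)
    S@(special ((_ , h₁) , (_ , h₂)) _ _) refl refl q₁ q₂ b≢ = e ,
    own b₁ b₂ ((q₁ , m+n≤o⇒n≤o a₁ h₁) , (q₂ , m+n≤o⇒n≤o a₂ h₂)) e
    where e = sym (difference a₁ a₂ b₁ b₂ S refl refl p₁ p₂ q₁ q₂ off b≢)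

  -- The summands lie on opposite diagonals off the main one, so the special colour of `(a₁ , a₂)`
  -- appears neither at the other summand nor at the sum.
  complement : ∀ a₁ a₂ b₁ b₂ s → Special m n c a₁ a₂ → a₁ + b₁ ≡ s → a₂ + b₂ ≡ s →
    1 ≤ b₁ → 1 ≤ b₂ → s ≤ m → s ≤ n → c b₁ b₂ ≡ c s s
  complement a₁ a₂ b₁ b₂ s (special ((p₁ , _) , (p₂ , _)) off own) e₁ e₂ q₁ q₂ h₁ h₂
    with nr a₁ a₂ b₁ b₂ e₁ e₂ p₁ p₂ q₁ q₂ h₁ h₂
  ... | inj₂ (inj₂ e) = e
  ... | inj₂ (inj₁ e) = ⊥-elim (off (sym (+-cancelˡ-≡ s a₂ a₁ (trans
        (own s s ((≤-trans p₁ (≤-trans (m≤m+n a₁ b₁) (≤-reflexive e₁)) , h₁)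
                 , (≤-trans p₁ (≤-trans (m≤m+n a₁ b₁) (≤-reflexive e₁)) , h₂)) (sym e))
        (+-comm a₁ s)))))
  ... | inj₁ e = ⊥-elim (off (sym (*-cancelˡ-≡ a₂ a₁ 2
        (≡-by (cong₂ _+_ (own b₁ b₂ ((q₁ , ≤-trans (m≤n+m b₁ a₁) (≤-trans (≤-reflexive e₁) h₁))
                                    , (q₂ , ≤-trans (m≤n+m b₂ a₂) (≤-trans (≤-reflexive e₂) h₂))) (sym e))
                        (sym (trans e₁ (sym e₂))))
              (solve (a₁ ∷ a₂ ∷ b₁ ∷ b₂ ∷ []))))))

  -- Otherwise `(y , 1 + y)` would lie below `(1 + x , x)`, but the offsets -1 and 1 fit neither
  -- case of `special-below`.
  opposite-near : ∀ x y → Special m n c (1 + x) x → Special m n c y (1 + y) → x ≤ suc y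
  opposite-near x y Sx Sy = ≮⇒≥ λ h → go (≤⇒≡+ h)
    where
    go : ∃ (λ k → x ≡ suc (suc y) + k) → ⊥
    go (k , refl) with special-below y (1 + y) (3 + k) (1 + k) Sy Sx
                         (solve (y ∷ k ∷ [])) (solve (y ∷ k ∷ [])) 1≤suc 1≤suc (λ e → ⊥-by 1 (≤-reflexive e) (solve (k ∷ [])))
    ... | _ , e = ⊥-by 2 (≤-reflexive e) (solve (y ∷ k ∷ []))

  -- The two points add up to a point of the main diagonal; if it were in the grid, this would be a
  -- rainbow solution.
  opposite-sum : ∀ ℓ x y → ℓ ≤ m → ℓ ≤ n → Special m n c (1 + x) x → Special m n c y (1 + y) → ℓ ≤ x + y
  opposite-sum ℓ x y ℓ≤m ℓ≤n Sx Sy@(special ((p , _) , _) off own) = ≮⇒≥ λ h →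
    ⊥-elim (off (sym (+-cancelˡ-≡ (suc (x + y)) (suc y) y (trans
       (own (suc (x + y)) (suc (x + y)) ((1≤suc , ≤-trans h ℓ≤m) , (1≤suc , ≤-trans h ℓ≤n))
         (sym (complement (1 + x) x y (1 + y) (suc (x + y)) Sx refl (+-suc x y) p 1≤suc (≤-trans h ℓ≤m) (≤-trans h ℓ≤n))))
       (+-comm y (suc (x + y)))))))

-- From (d + w , w) on, the path of first special points runs along row d + w to the first column.
Flat : ℕ → ℕ → Coloring → ℕ → ℕ → Set
Flat m n c d w = ∀ i j → i + j ≡ w → 1 ≤ j → First m n c (i + d) j

Red : Coloring → ℕ → Set
Red c w = ∀ h → 1 ≤ h → h < w → c h h ≡ c 1 1

RedColumn : Coloring → ℕ → Set
RedColumn c p = ∀ i → 2 ≤ i → i ≤ p → c i 1 ≡ c 1 1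

red-suc : ∀ {c w} → Red c w → (1 ≤ w → c w w ≡ c 1 1) → Red c (suc w)
red-suc R e h 1≤h (s≤s h≤w) with m≤n⇒m<n∨m≡n h≤w
... | inj₁ h<w = R h 1≤h h<w
... | inj₂ refl = e 1≤h

steps : ∀ {f : ℕ → ℕ} {p} → (∀ i → 2 ≤ i → suc i ≤ p → f i ≡ f (suc i)) →
  ∀ k i → i + k ≡ p → 2 ≤ i → f i ≡ f p
steps s zero i e 2≤i = cong _ (trans (sym (+-identityʳ i)) e)
steps s (suc k) i e 2≤i = trans (s i 2≤i (subst (suc i ≤_) e (≤-trans (m≤m+n (suc i) k) (≤-reflexive (sym (+-suc i k))))))
  (steps s k (suc i) (trans (sym (+-suc i k)) e) (m≤n⇒m≤1+n 2≤i))

-- First special points and the first column.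

module _ {m n : ℕ} {c : Coloring} (nr : NoRainbow m n c) where

  special-recolour : ∀ {p₁ p₂ q₁ q₂} → Special m n c p₁ p₂ → InGrid m n q₁ q₂ →
    c q₁ q₂ ≡ c p₁ p₂ → Special m n c q₁ q₂
  special-recolour {p₁} {p₂} {q₁} {q₂} (special _ off own) g e = special g
    (λ { refl → off (+-cancelʳ-≡ q₁ p₁ p₂ (sym (trans (+-comm p₂ q₁) o))) })
    λ i j h e′ → ≡-by (cong₂ _+_ (own i j h (trans e′ e)) (sym o)) (solve (i ∷ j ∷ p₁ ∷ p₂ ∷ q₁ ∷ q₂ ∷ []))
    where o = own q₁ q₂ g e

  -- An earlier point has a colour from the main diagonal and hence is not special.
  first-least : ∀ {x v} → First m n c 1 x → Special m n c (1 + v) v → x ≤ v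
  first-least {x} {v} (special ((_ , g₁) , (_ , g₂)) _ _ , below) (special (_ , (1≤v , _)) _ own) =
    ≮⇒≥ λ v<x → go (≤⇒≡+ v<x)
    where
    go : ∃ (λ k → x ≡ suc v + k) → ⊥
    go (k , refl) = ⊥-by 0 (≤-reflexive (sym (own (suc k) (suc k)
        ((1≤suc , ≤-by (suc v) g₁ (solve (m ∷ v ∷ k ∷ []))) , (1≤suc , ≤-by v g₂ (solve (n ∷ v ∷ k ∷ []))))
        (sym (below v (suc k) 1≤v 1≤suc (+-suc v k)))))) (solve (v ∷ k ∷ []))

  column-value : ∀ d q → First m n c d (suc q) → 1 ≤ q → c (suc d) 1 ≡ c q q
  column-value d q (_ , below) 1≤q = trans (cong (λ t → c t 1) (+-comm 1 d)) (below 1 q ≤-refl 1≤q refl)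

  -- Each step of a flat path goes to the next offset and the previous column, so the first column,
  -- read by increasing row, repeats the main diagonal in reverse.
  flat-value : ∀ d w → Flat m n c d w → ∀ h k → 1 ≤ h → suc h + k ≡ w → c (suc (k + d)) 1 ≡ c h h
  flat-value d w fl h k 1≤h e = column-value (k + d) h (fl k (suc h) (trans (+-comm k (suc h)) e) 1≤suc) 1≤h

  -- The two special points are neighbours in one column, so the same point `(suc b , q)` completes
  -- `(i , 1)` to one and `(suc i , 1)` to the other.
  column-step : ∀ d q → First m n c d (suc q) → First m n c (suc d) (suc q) → 1 ≤ q →
    ∀ i → 2 ≤ i → suc i ≤ d + suc q → c i 1 ≡ c (suc i) 1
  column-step d q F F′ 1≤q i 2≤i h with ≤⇒≡+ h
  ... | b , e with suc b ≟ q
  -- Here the completing point is `(q , q)`, to which `difference` does not apply; `column-value`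
  -- gives both colours instead.
  ...   | yes refl = trans (cong (λ t → c t 1) i≡) (trans (column-value d q F 1≤q)
            (trans (sym (column-value (suc d) q F′ 1≤q)) (cong (λ t → c (suc t) 1) (sym i≡))))
          where
          i≡ : i ≡ suc d
          i≡ = ≡-by (sym e) (solve (i ∷ d ∷ b ∷ []))
  ...   | no b≢ = trans
            (difference nr i 1 (suc b) q (proj₁ F) (trans (+-suc i b) (sym e)) refl
               (≤-trans (s≤s z≤n) 2≤i) ≤-refl 1≤suc 1≤q i≢1 b≢)
            (sym (difference nr (suc i) 1 (suc b) q (proj₁ F′) (cong suc (trans (+-suc i b) (sym e))) refl
               1≤suc ≤-refl 1≤suc 1≤q (λ { refl → contradiction 2≤i λ () }) b≢))
          where
          i≢1 : i ≢ 1
          i≢1 refl = contradiction 2≤i λ { (s≤s ()) }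

  -- The staircase on one side of the main diagonal.

  module LowerPath {x y : ℕ} (Fx : First m n c 1 x) (3≤x : 3 ≤ x) (Sy : Special m n c y (1 + y))
                   (low : ∀ d → 1 ≤ d → d < m → ∃ (First m n c d)) where

    -- The case w < w′ would force d = 1 and a special point of offset 2 above (y , 1 + y).
    adjacent : ∀ d w w′ → First m n c d w → First m n c (suc d) w′ → w′ ≡ w ⊎ suc w′ ≡ w
    adjacent d w w′ F F′ with <-cmp w w′
    ... | tri≈ _ e _ = inj₁ (sym e)
    ... | tri> _ _ w′<w with ≤⇒≡+ w′<w
    ...   | zero , e = inj₂ (trans (sym (+-identityʳ _)) (sym e))
    ...   | suc k , refl with special-below nr (suc d + w′) w′ (1 + k) (2 + k) (proj₁ F′) (proj₁ F)
                               (solve (d ∷ w′ ∷ k ∷ [])) (solve (d ∷ w′ ∷ k ∷ [])) 1≤suc 1≤suc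
                               (λ e → ⊥-by 0 (≤-reflexive (sym e)) (solve (k ∷ [])))
    ...     | _ , o = ⊥-elim (⊥-by (1 + d) (≤-reflexive (sym o)) (solve (d ∷ w′ ∷ k ∷ [])))
    adjacent d w w′ F F′ | tri< w<w′ _ _ with ≤⇒≡+ w<w′
    ... | k , refl with special-below nr (d + w) w (2 + k) (1 + k) (proj₁ F) (proj₁ F′)
                               (solve (d ∷ w ∷ k ∷ [])) (solve (w ∷ k ∷ [])) 1≤suc 1≤suc
                               (λ e → ⊥-by 0 (≤-reflexive e) (solve (k ∷ [])))
    ...   | e , o with ≡-by {a = d} {b = 1} (sym o) (solve (d ∷ w ∷ k ∷ []))
    ...     | refl with proj₁ F′
    ...       | S′@(special ((_ , h₁) , (_ , h₂)) _ _) =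
      ⊥-elim (go (≤⇒≡+ (≤-by 0 {a = 2 + y} {b = suc w + k} (opposite-near′ ⊹ 3≤1+k) (solve (y ∷ w ∷ k ∷ [])))))
      where
      -- The difference has the colour of the special point in `F`, so it is special and comes no
      -- earlier than that point; this puts `F′` past `(y , 1 + y)`.
      Sβ : Special m n c (2 + k) (1 + k)
      Sβ = special-recolour (proj₁ F)
             ((1≤suc , ≤-by (suc w) h₁ (solve (m ∷ w ∷ k ∷ []))) , (1≤suc , ≤-by w h₂ (solve (n ∷ w ∷ k ∷ [])))) e
      3≤1+k : 3 ≤ 1 + k
      3≤1+k = ≤-trans 3≤x (≤-trans (first-least Fx (proj₁ F)) (first-least F Sβ))
      opposite-near′ : y ≤ suc w
      opposite-near′ = opposite-near (noRainbow-flip nr) y w (special-flip Sy) (special-flip (proj₁ F))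
      go : ∃ (λ t → suc w + k ≡ (2 + y) + t) → ⊥
      go (t , e′) with special-below nr y (1 + y) (4 + t) (1 + t) Sy S′
                        (≡-by (sym e′) (solve (y ∷ t ∷ w ∷ k ∷ []))) (≡-by (sym e′) (solve (y ∷ t ∷ w ∷ k ∷ [])))
                        1≤suc 1≤suc (λ e → ⊥-by 2 (≤-reflexive e) (solve (t ∷ [])))
      ... | _ , o′ = ⊥-by 3 (≤-reflexive o′) (solve (y ∷ t ∷ []))

    -- A step of the path from (d + w , w) to (suc d + w , w) with 2 ≤ w makes the first
    -- column constant up to row d + w; the last such step gives the colour c 1 1.
    lower : ∀ k d w → k + d ≡ m → 1 ≤ d → First m n c d w → Flat m n c d w ⊎ (RedColumn c (suc d) × Red c w)
    lower k d zero e 1≤d (special (_ , () , _) _ _ , _)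
    lower k d (suc zero) e 1≤d F = inj₁ λ where
      zero (suc zero) _ _ → F
      (suc i) (suc j) e _ → contradiction (suc-injective e) λ e′ → contradiction (trans (sym (+-suc i j)) e′) λ ()
    lower zero d (suc (suc w)) refl 1≤d (special ((_ , h) , _) _ _ , _) =
      ⊥-elim (⊥-by (suc w) h (solve (d ∷ w ∷ [])))
    lower (suc k) d (suc (suc w)) e 1≤d F@(special ((_ , h) , _) _ _ , _)
      with low (suc d) 1≤suc (≤-by w h (solve (m ∷ d ∷ w ∷ [])))
    ... | w′ , F′ with lower k (suc d) w′ (trans (+-suc k d) e) 1≤suc F′ | adjacent d (suc (suc w)) w′ F F′
    ...   | inj₂ (rc , r) | inj₁ refl = inj₂ ((λ i 2≤i i≤ → rc i 2≤i (m≤n⇒m≤1+n i≤)) , r)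
    ...   | inj₂ (rc , r) | inj₂ refl = inj₂ ((λ i 2≤i i≤ → rc i 2≤i (m≤n⇒m≤1+n i≤)) ,
              -- Row `suc d` of the first column has the colour of `(suc w , suc w)`, and the later
              -- part of the path has made it red.
              red-suc {c} r (λ _ → trans (sym (column-value d (suc w) F 1≤suc)) (rc (suc d) (s≤s 1≤d) (n≤1+n _))))
    ...   | inj₁ fl | inj₂ refl = inj₁ λ where
              zero j refl _ → F
              (suc i) j eq 1≤j → subst (λ t → First m n c t j) (+-suc i d) (fl i j (suc-injective eq) 1≤j)
    ...   | inj₁ fl | inj₁ refl = inj₂ ((λ i 2≤i i≤ → redc i 2≤i (≤-trans i≤ (≤-by (suc w) (z≤n {0}) (solve (d ∷ w ∷ []))))) ,
              λ h 1≤h h<w → go h 1≤h (≤⇒≡+ h<w))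
      where
      top : d + suc (suc w) ≡ suc (w + suc d)
      top = solve (d ∷ w ∷ [])
      redc : RedColumn c (d + suc (suc w))
      redc i 2≤i i≤ = let j , e = ≤⇒≡+ i≤ in
        trans (steps {λ t → c t 1} (column-step d (suc w) F F′ 1≤suc) j i (sym e) 2≤i)
          (trans (cong (λ t → c t 1) top) (flat-value (suc d) _ fl 1 w ≤-refl refl))
      go : ∀ h → 1 ≤ h → ∃ (λ j → suc (suc w) ≡ suc h + j) → c h h ≡ c 1 1
      -- The flat continuation copies `(h , h)` into the first column, within the stretch that
      -- `redc` covers.
      go h 1≤h (j , e) = trans (sym (flat-value (suc d) _ fl h j 1≤h (sym e)))
        (redc (suc (j + suc d)) (s≤s (≤-trans (s≤s z≤n) (m≤n+m (suc d) j)))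
          (≤-by 0 (≤-reflexive (sym e) ⊹ 1≤h) (solve (d ∷ w ∷ h ∷ j ∷ []))))

-- The three colours of the main diagonal.

-- Red is the colour of `(1 , 1)`; blue and green are the next two colours, first met at `(b , b)`
-- and `(g , g)`.
record Palette (c : Coloring) (ℓ b g : ℕ) : Set where
  field
    2≤b   : 2 ≤ b
    1≤g   : 1 ≤ g
    g≤ℓ   : g ≤ ℓ
    red   : Red c b
    b≢red : c b b ≢ c 1 1
    g≢red : c g g ≢ c 1 1
    g≢b   : c g g ≢ c b b
    old   : ∀ i → 1 ≤ i → i < g → c i i ≡ c 1 1 ⊎ c i i ≡ c b b

  least-green : ∀ i → 1 ≤ i → c i i ≡ c g g → g ≤ i
  least-green i 1≤i e = ≮⇒≥ λ i<g → go (old i 1≤i i<g)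
    where
    go : c i i ≡ c 1 1 ⊎ c i i ≡ c b b → ⊥
    go (inj₁ e′) = g≢red (trans (sym e) e′)
    go (inj₂ e′) = g≢b (trans (sym e) e′)

palette-flip : ∀ {c ℓ b g} → Palette c ℓ b g → Palette (flip c) ℓ b g
palette-flip P = record { Palette P }

-- Straight staircases against the three colours.

module _ {m n : ℕ} {c : Coloring} (nr : NoRainbow m n c) where

  -- The special points `(2 + x , 1 + x)` and `(2 + x , x)` are neighbours in a row, so two
  -- neighbours in the first row have a common complement `(1 + x , 1 + t)` and hence one colour.
  -- The flat path on the other side carries their colours to the main diagonal.
  flat-step : ∀ x y → First m n c 1 (suc x) → First m n c 2 x → Flat n m (flip c) 1 y →
    ∀ h → 1 ≤ h → 2 + h ≤ y → 2 + y ≤ suc x + h → c (suc h) (suc h) ≡ c h h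
  flat-step x y F₁ F₂ fl h 1≤h h≤ y≤ with ≤⇒≡+ h≤
  ... | i , refl with ≤⇒≡+ (≤-by 0 {a = suc (suc (i + 1))} {b = x} y≤ (solve (x ∷ h ∷ i ∷ [])))
  ...   | t , refl = trans (sym (flat-value (noRainbow-flip nr) 1 y fl (suc h) i 1≤suc refl))
          (trans row (flat-value (noRainbow-flip nr) 1 y fl h (suc i) 1≤h (cong suc (+-suc h i))))
    where
    x≢t : suc x ≢ suc t
    x≢t e = ⊥-by (i + 2) (≤-reflexive e) (solve (i ∷ t ∷ []))
    row : c 1 (suc (i + 1)) ≡ c 1 (suc (suc i + 1))
    row = trans
      (difference nr 1 (suc (i + 1)) (suc x) (suc t) (proj₁ F₂) refl (+-suc (suc (i + 1)) t)
        ≤-refl 1≤suc 1≤suc 1≤suc (λ e → ⊥-by i (≤-reflexive (sym e)) (solve (i ∷ []))) x≢t)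
      (sym (difference nr 1 (suc (suc i + 1)) (suc x) (suc t) (proj₁ F₁) refl (+-suc (suc (suc i + 1)) t)
        ≤-refl 1≤suc 1≤suc 1≤suc (λ e → ⊥-by (suc i) (≤-reflexive (sym e)) (solve (i ∷ []))) x≢t))

  flat-unequal : ∀ x y → y < suc x → First m n c 1 (suc x) → First m n c 2 x →
    Flat n m (flip c) 1 y → Red c y
  flat-unequal x y y<x F₁ F₂ fl (suc zero) 1≤h h<y = refl
  flat-unequal x y y<x F₁ F₂ fl (suc (suc h)) 1≤h h<y =
    trans (flat-step x y F₁ F₂ fl (suc h) 1≤suc h<y (≤-by h y<x (solve (x ∷ y ∷ h ∷ []))))
          (flat-unequal x y y<x F₁ F₂ fl (suc h) 1≤suc (<-trans (n<1+n _) h<y))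

  -- At `h = 1` the common complement of `flat-step` would lie in column 0, so the chain starts at 2
  -- and leaves `(1 , 1)` out.
  flat-equal : ∀ x → First m n c 1 (suc x) → First m n c 2 x → Flat n m (flip c) 1 (suc x) →
    ∀ h → 2 ≤ h → h < suc x → c h h ≡ c 2 2
  flat-equal x F₁ F₂ fl (suc (suc zero)) 2≤h h< = refl
  flat-equal x F₁ F₂ fl (suc zero) (s≤s ()) h<
  flat-equal x F₁ F₂ fl (suc (suc (suc h))) 2≤h h< =
    trans (flat-step x (suc x) F₁ F₂ fl (suc (suc h)) 1≤suc h< (≤-by h (z≤n {0}) (solve (x ∷ h ∷ []))))
          (flat-equal x F₁ F₂ fl (suc (suc h)) (s≤s (s≤s z≤n)) (<-trans (n<1+n _) h<))

  module WithPalette {ℓ b g : ℕ} (P : Palette c ℓ b g) (ℓ≤m : ℓ ≤ m) (ℓ≤n : ℓ ≤ n) where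
    open Palette P

    -- Otherwise `g - b < b`, so a blue point and a red one add up to the green `(g , g)`.
    b+b≤g : b + b ≤ g
    b+b≤g = ≮⇒≥ go
      where
      b<g : b < g
      b<g = ≤∧≢⇒< (≮⇒≥ λ g<b → g≢red (red g 1≤g g<b)) λ { refl → g≢b refl }
      go : g < b + b → ⊥
      go h with ≤⇒≡+ b<g
      ... | k , e with red (suc k) 1≤suc (+-cancelˡ-< b (suc k) b (subst (_< b + b) (trans e (sym (+-suc b k))) h))
      ...   | r with nr b b (suc k) (suc k) (trans (+-suc b k) (sym e)) (trans (+-suc b k) (sym e))
                       (≤-trans (s≤s z≤n) 2≤b) (≤-trans (s≤s z≤n) 2≤b) 1≤suc 1≤suc (≤-trans g≤ℓ ℓ≤m) (≤-trans g≤ℓ ℓ≤n)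
      ...     | inj₁ e′ = b≢red (trans e′ r)
      ...     | inj₂ (inj₁ e′) = g≢b (sym e′)
      ...     | inj₂ (inj₂ e′) = g≢red (trans (sym e′) r)

    4≤g : 4 ≤ g
    4≤g = ≤-trans (2≤b ⊹ 2≤b) b+b≤g

    -- If `g ≥ x + 2`, the complement of `(1 + x , x)` in `(g , g)` is green and precedes
    -- `(y , 1 + y)`; `below` then moves green to a point of the main diagonal before `(g , g)`.
    green-bound : ∀ x y → First m n c 1 x → First n m (flip c) 1 y → ℓ ≤ x + y → y ≤ suc x → g ≤ suc x
    green-bound x y (Sx , _) (_ , below) ℓ≤ y≤ = ≮⇒≥ λ h → go (≤⇒≡+ h)
      where
      go : ∃ (λ i → g ≡ suc (suc x) + i) → ⊥
      go (i , e) with ≤⇒≡+ (≤-by 0 {a = suc (suc i)} {b = y}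
                        (≤-trans (≤-reflexive (sym e)) (≤-trans g≤ℓ ℓ≤)) (solve (x ∷ y ∷ i ∷ [])))
      ... | k , e′ = ⊥-by (1 + i + i)
            (least-green (suc k) 1≤suc (trans (sym reflected) green) ⊹ ≤-reflexive (sym e) ⊹ ≤-reflexive (sym e′) ⊹ y≤)
            (solve (g ∷ x ∷ y ∷ i ∷ k ∷ []))
        where
        reflected : c (suc i) (suc (suc i)) ≡ c (suc k) (suc k)
        reflected = below (suc i) (suc k) 1≤suc 1≤suc (trans (cong suc (+-suc i k)) (sym e′))
        sum : suc (x + suc i) ≡ g
        sum = trans (cong suc (+-suc x i)) (sym e)
        green : c (suc i) (suc (suc i)) ≡ c g g
        green = complement nr (1 + x) x (suc i) (suc (suc i)) g Sx sum (trans (+-suc x (suc i)) sum)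
                  1≤suc 1≤suc (≤-trans g≤ℓ ℓ≤m) (≤-trans g≤ℓ ℓ≤n)

    -- `b` is at least `x`, so `x + x ≤ b + b ≤ g ≤ x + 1`.
    red-impossible : ∀ x → 3 ≤ x → g ≤ suc x → Red c x → ⊥
    red-impossible x 3≤x g≤ R = ⊥-by 1 (x≤b ⊹ x≤b ⊹ b+b≤g ⊹ g≤ ⊹ 3≤x) (solve (x ∷ b ∷ g ∷ []))
      where
      x≤b : x ≤ b
      x≤b = ≮⇒≥ λ b<x → b≢red (R b (≤-trans (s≤s z≤n) 2≤b) b<x)

    flat-impossible : ∀ x → 2 ≤ x → First m n c 1 (suc x) → First m n c 2 x →
      First n m (flip c) 1 (suc x) → Flat n m (flip c) 1 (suc x) → g ≤ suc (suc x) → ⊥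
    flat-impossible x 2≤x F₁ F₂ (_ , below) fl g≤ with c 2 2 ≟ c 1 1
    ... | yes e = red-impossible (suc x) (s≤s 2≤x) g≤ R
      where
      R : Red c (suc x)
      R (suc zero) _ _ = refl
      R (suc (suc h)) 1≤h h< = trans (flat-equal x F₁ F₂ fl (suc (suc h)) (s≤s (s≤s z≤n)) h<) e
    ... | no 2≢red with ≤-antisym 2≤b (≮⇒≥ λ 2<b → 2≢red (red 2 1≤suc 2<b))
    ...   | refl with <-cmp g (suc x)
    ...     | tri< g<x _ _ = g≢b (flat-equal x F₁ F₂ fl g (≤-trans (s≤s (s≤s z≤n)) 4≤g) g<x)
    -- `(1 , 1)` is red, `(x , x)` is blue and their sum is green.
    ...     | tri≈ _ refl _ with nr 1 1 x x refl refl ≤-refl ≤-refl (<⇒≤ 2≤x) (<⇒≤ 2≤x) (≤-trans g≤ℓ ℓ≤m) (≤-trans g≤ℓ ℓ≤n)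
    ...       | inj₁ e = b≢red (trans (sym (flat-equal x F₁ F₂ fl x 2≤x (n<1+n x))) (sym e))
    ...       | inj₂ (inj₁ e) = g≢red (sym e)
    ...       | inj₂ (inj₂ e) = g≢b (trans (sym e) (flat-equal x F₁ F₂ fl x 2≤x (n<1+n x)))
    flat-impossible x 2≤x F₁ F₂ (_ , below) fl g≤ | no 2≢red | refl | tri> _ _ x<g
      with ≤-antisym x<g g≤
    -- `(2 , 1)` is blue like `(x , x)`, and `(x , suc x)` is red like `(1 , 1)`; their sum is
    -- green.
    ... | refl with nr 2 1 x (suc x) refl refl 1≤suc 1≤suc (<⇒≤ 2≤x) 1≤suc (≤-trans g≤ℓ ℓ≤m) (≤-trans g≤ℓ ℓ≤n)
                  | trans (column-value nr 1 x F₁ (<⇒≤ 2≤x)) (flat-equal x F₁ F₂ fl x 2≤x (n<1+n x))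
                  | below x 1 (<⇒≤ 2≤x) ≤-refl (+-comm x 1)
    ... | inj₁ e | blue | red′ = b≢red (trans (sym blue) (trans e red′))
    ... | inj₂ (inj₁ e) | blue | red′ = g≢b (trans (sym e) blue)
    ... | inj₂ (inj₂ e) | blue | red′ = g≢red (trans (sym e) red′)

-- The contradiction from both halves.

-- If both halves are flat with different lengths, the first two points of the longer one make the
-- main diagonal red below the length of the shorter.
staircases-impossible : ∀ {m n c ℓ b g x y} → NoRainbow m n c → Palette c ℓ b g → ℓ ≤ m → ℓ ≤ n →
  First m n c 1 x → First n m (flip c) 1 y → 3 ≤ x → 3 ≤ y → g ≤ suc x → g ≤ suc y →
  Flat m n c 1 x ⊎ Red c x → Flat n m (flip c) 1 y ⊎ Red c y → ⊥
staircases-impossible nr P ℓ≤m ℓ≤n Fx Fy 3≤x 3≤y gx gy (inj₂ R) _ =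
  WithPalette.red-impossible nr P ℓ≤m ℓ≤n _ 3≤x gx R
staircases-impossible nr P ℓ≤m ℓ≤n Fx Fy 3≤x 3≤y gx gy (inj₁ _) (inj₂ R) =
  WithPalette.red-impossible nr P ℓ≤m ℓ≤n _ 3≤y gy R
staircases-impossible {x = suc x} {suc y} nr P ℓ≤m ℓ≤n Fx Fy 3≤x 3≤y gx gy (inj₁ fx) (inj₁ fy) with <-cmp x y
... | tri< x<y _ _ = WithPalette.red-impossible nr P ℓ≤m ℓ≤n (suc x) 3≤x gx
        (flat-unequal (noRainbow-flip nr) y (suc x) (s≤s x<y) Fy (fy 1 y refl (<⇒≤ (s≤s⁻¹ 3≤y))) fx)
... | tri> _ _ y<x = WithPalette.red-impossible nr P ℓ≤m ℓ≤n (suc y) 3≤y gy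
        (flat-unequal nr x (suc y) (s≤s y<x) Fx (fx 1 x refl (<⇒≤ (s≤s⁻¹ 3≤x))) fy)
... | tri≈ _ refl _ =
        WithPalette.flat-impossible nr P ℓ≤m ℓ≤n x (s≤s⁻¹ 3≤x) Fx (fx 1 x refl (<⇒≤ (s≤s⁻¹ 3≤x))) Fy fy gx

lower-half : ∀ {m n c x y} → NoRainbow m n c → First m n c 1 x → 3 ≤ x → Special m n c y (1 + y) →
  (∀ d → 1 ≤ d → d < m → ∃ (First m n c d)) → Flat m n c 1 x ⊎ Red c x
lower-half {m} {n} {c} {x} nr Fx@(special ((_ , h) , _) _ _ , _) 3≤x Sy low = go (≤⇒≡+ (≤-trans (s≤s z≤n) h))
  where
  go : ∃ (λ k → m ≡ 1 + k) → Flat m n c 1 x ⊎ Red c x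
  go (k , e) = map₂ proj₂ (LowerPath.lower nr Fx 3≤x Sy low k 1 x (trans (+-comm k 1) (sym e)) ≤-refl Fx)

three-coloured-diagonal-impossible : ∀ {m n c ℓ b g} → NoRainbow m n c → Palette c ℓ b g → ℓ ≤ m → ℓ ≤ n →
  (∀ d → 1 ≤ d → d < m → ∃ (First m n c d)) →
  (∀ d → 1 ≤ d → d < n → ∃ (First n m (flip c) d)) → ⊥
three-coloured-diagonal-impossible {m} {n} {c} {ℓ} {g = g} nr P ℓ≤m ℓ≤n low low′ =
  go (low 1 ≤-refl (≤-trans 2≤ℓ ℓ≤m)) (low′ 1 ≤-refl (≤-trans 2≤ℓ ℓ≤n))
  where
  4≤g : 4 ≤ g
  4≤g = WithPalette.4≤g nr P ℓ≤m ℓ≤n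
  2≤ℓ : 2 ≤ ℓ
  2≤ℓ = ≤-trans (s≤s (s≤s z≤n)) (≤-trans 4≤g (Palette.g≤ℓ P))
  go : ∃ (First m n c 1) → ∃ (First n m (flip c) 1) → ⊥
  go (x , Fx) (y , Fy) = staircases-impossible nr P ℓ≤m ℓ≤n Fx Fy 3≤x 3≤y g≤1+x g≤1+y
      (lower-half nr Fx 3≤x Sy low) (lower-half nr′ Fy 3≤y Sx low′)
    where
    nr′ : NoRainbow n m (flip c)
    nr′ = noRainbow-flip nr
    Sx : Special n m (flip c) x (1 + x)
    Sx = special-flip (proj₁ Fx)
    Sy : Special m n c y (1 + y)
    Sy = special-flip (proj₁ Fy)
    ℓ≤x+y : ℓ ≤ x + y
    ℓ≤x+y = opposite-sum nr ℓ x y ℓ≤m ℓ≤n (proj₁ Fx) Sy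
    g≤1+x : g ≤ suc x
    g≤1+x = WithPalette.green-bound nr P ℓ≤m ℓ≤n x y Fx Fy ℓ≤x+y
              (opposite-near nr′ y x (proj₁ Fy) Sx)
    g≤1+y : g ≤ suc y
    g≤1+y = WithPalette.green-bound nr′ (palette-flip P) ℓ≤n ℓ≤m y x Fy Fx
              (≤-trans ℓ≤x+y (≤-reflexive (+-comm x y))) (opposite-near nr x y (proj₁ Fx) Sy)
    3≤x : 3 ≤ x
    3≤x = s≤s⁻¹ (≤-trans 4≤g g≤1+x)
    3≤y : 3 ≤ y
    3≤y = s≤s⁻¹ (≤-trans 4≤g g≤1+y)

-- Existence of first special points and of the palette.

least : ∀ {P : ℕ → Set} → Decidable P → ∀ n → P n → ∃ λ k → k ≤ n × P k × (∀ i → i < k → ¬ P i)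
least {P} P? n Pn with search n
  where
  search : ∀ n → (∃ λ k → k ≤ n × P k × (∀ i → i < k → ¬ P i)) ⊎ (∀ i → i < n → ¬ P i)
  search zero = inj₂ λ _ ()
  search (suc n) with search n
  ... | inj₁ (k , k≤n , Pk , min) = inj₁ (k , m≤n⇒m≤1+n k≤n , Pk , min)
  ... | inj₂ none with P? n
  ...   | yes Pn = inj₁ (n , n≤1+n n , Pn , none)
  ...   | no ¬Pn = inj₂ λ i i<1+n → case i (m≤n⇒m<n∨m≡n (s≤s⁻¹ i<1+n))
    where
    case : ∀ i → i < n ⊎ i ≡ n → ¬ P i
    case i (inj₁ i<n) = none i i<n
    case i (inj₂ refl) = ¬Pn
... | inj₁ found = found
... | inj₂ none = n , ≤-refl , Pn , none

-- Take the first point of the diagonal with the special colour. Neither an earlier point nor a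
-- point `(k , k)` has that colour, so two such summands of it must agree.
first-exists : ∀ {m n c} → NoRainbow m n c → ∀ d x → 1 ≤ d → Special m n c (d + x) x → ∃ (First m n c d)
first-exists {m} {n} {c} nr d x 1≤d S@(special ((_ , hm) , (1≤x , hn)) _ own)
  with least {λ i → 1 ≤ i × c (d + i) i ≡ c (d + x) x} (λ i → (1 ≤? i) ×-dec (_ ≟ _)) x (1≤x , refl)
... | w , w≤x , (1≤w , e) , min = w , S′ , below
  where
  w≤m : d + w ≤ m
  w≤m = ≤-trans (+-monoʳ-≤ d w≤x) hm
  w≤n : w ≤ n
  w≤n = ≤-trans w≤x hn
  S′ : Special m n c (d + w) w
  S′ = special-recolour nr S ((≤-trans 1≤w (m≤n+m w d) , w≤m) , (1≤w , w≤n)) e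
  below : ∀ i k → 1 ≤ i → 1 ≤ k → i + k ≡ w → c (d + i) i ≡ c k k
  below i k 1≤i 1≤k refl with nr (d + i) i k k (+-assoc d i k) refl (≤-trans 1≤i (m≤n+m i d)) 1≤i 1≤k 1≤k w≤m w≤n
  ... | inj₁ e′ = e′
  ... | inj₂ (inj₁ e′) = contradiction (1≤i , trans e′ e) (min i (m<m+n i 1≤k))
  ... | inj₂ (inj₂ e′) = ⊥-elim (<⇒≢ 1≤d (sym (+-cancelʳ-≡ (i + k + k) d 0
          (≡-by (sym (Special.own S′ k k ((1≤k , ≤-trans (m≤n+m k (d + i)) (≤-trans (≤-reflexive (+-assoc d i k)) w≤m))
                                          , (1≤k , ≤-trans (m≤n+m k i) w≤n)) e′))
                (solve (d ∷ i ∷ k ∷ []))))))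

palette-exists : ∀ {c ℓ} p q r → 1 ≤ p → p ≤ ℓ → 1 ≤ q → q ≤ ℓ → 1 ≤ r → r ≤ ℓ →
  c p p ≢ c q q → c p p ≢ c r r → c q q ≢ c r r → ∃ λ b → ∃ λ g → Palette c ℓ b g
palette-exists {c} {ℓ} p q r 1≤p p≤ 1≤q q≤ 1≤r r≤ pq pr qr = go blue
  where
  New : ℕ → ℕ → ℕ → Set
  New u v i = 1 ≤ i × c i i ≢ u × c i i ≢ v
  new? : ∀ u v → Decidable (New u v)
  new? u v i = (1 ≤? i) ×-dec (¬? (c i i ≟ u) ×-dec ¬? (c i i ≟ v))
  -- Three distinct colours cannot all be among `u` and `v`.
  new-exists : ∀ u v → ∃ λ i → i ≤ ℓ × New u v i
  new-exists u v with new? u v p | new? u v q | new? u v r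
  ... | yes N | _ | _ = p , p≤ , N
  ... | no _ | yes N | _ = q , q≤ , N
  ... | no _ | no _ | yes N = r , r≤ , N
  ... | no ¬p | no ¬q | no ¬r with c p p ≟ u | c q q ≟ u
  ...   | yes refl | yes e = ⊥-elim (pq (sym e))
  ...   | yes refl | no q≢u with c q q ≟ v
  ...     | yes refl = ⊥-elim (¬r (1≤r , (λ e → pr (sym e)) , (λ e → qr (sym e))))
  ...     | no q≢v = ⊥-elim (¬q (1≤q , q≢u , q≢v))
  new-exists u v | no ¬p | no ¬q | no ¬r | no p≢u | q? with c p p ≟ v
  ...   | no p≢v = ⊥-elim (¬p (1≤p , p≢u , p≢v))
  ...   | yes refl with q?
  ...     | yes refl = ⊥-elim (¬r (1≤r , (λ e → qr (sym e)) , (λ e → pr (sym e))))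
  ...     | no q≢u = ⊥-elim (¬q (1≤q , q≢u , (λ e → pq (sym e))))
  Least : ℕ → ℕ → ℕ → Set
  Least u v k = k ≤ ℓ × New u v k × (∀ i → i < k → ¬ New u v i)
  least-new : ∀ u v → ∃ (Least u v)
  least-new u v with new-exists u v
  ... | i , i≤ℓ , N with least (new? u v) i N
  ...   | k , k≤i , N′ , min = k , ≤-trans k≤i i≤ℓ , N′ , min
  -- Equal arguments exclude red alone.
  blue = least-new (c 1 1) (c 1 1)
  go : ∃ (Least (c 1 1) (c 1 1)) → ∃ λ b → ∃ λ g → Palette c ℓ b g
  go (b , _ , (1≤b , b≢red , _) , minb) with least-new (c 1 1) (c b b)
  ... | g , g≤ℓ , (1≤g , g≢red , g≢b) , ming = b , g , record
    { 2≤b = ≤∧≢⇒< 1≤b λ { refl → b≢red refl }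
    ; 1≤g = 1≤g ; g≤ℓ = g≤ℓ
    ; red = red
    ; b≢red = b≢red ; g≢red = g≢red ; g≢b = g≢b
    ; old = old }
    where
    red : Red c b
    red i 1≤i i<b with c i i ≟ c 1 1
    ... | yes e = e
    ... | no ne = ⊥-elim (minb i i<b (1≤i , ne , ne))
    old : ∀ i → 1 ≤ i → i < g → c i i ≡ c 1 1 ⊎ c i i ≡ c b b
    old i 1≤i i<g with c i i ≟ c 1 1 | c i i ≟ c b b
    ... | yes e | _ = inj₁ e
    ... | no _ | yes e = inj₂ e
    ... | no ne | no ne′ = ⊥-elim (ming i i<g (1≤i , ne , ne′))

-- A pigeonhole principle for relations.

injective⇒surjective : ∀ {n} (f : Fin n → Fin n) → (∀ {i j} → f i ≡ f j → i ≡ j) → ∀ s → ∃ λ k → f k ≡ s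
injective⇒surjective {suc n} f inj s with any? (λ k → f k ≟ᶠ s)
... | yes found = found
... | no missed = contradiction
      (injective⇒≤ {f = λ k → punchOut (avoids k)} (λ {i} {j} e → inj (punchOut-injective (avoids i) (avoids j) e)))
      (n≮n n)
  where
  avoids : ∀ k → s ≢ f k
  avoids k e = missed (k , sym e)

-- `k` may a priori be related to several `s`; since a choice of one for each `k` is already a
-- bijection, `functional` excludes this.
module Pigeonhole {N : ℕ} {R : ℕ → ℕ → Set}
                  (total : ∀ k → 1 ≤ k → k ≤ N → ∃ λ s → s < N × R k s)
                  (injective : ∀ {k k′ s} → R k s → R k′ s → k ≡ k′) where

  image : (κ : Fin N) → ∃ λ s → s < N × R (suc (toℕ κ)) s
  image κ = total (suc (toℕ κ)) 1≤suc (toℕ<n κ)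

  imageᶠ : Fin N → Fin N
  imageᶠ κ = fromℕ< (proj₁ (proj₂ (image κ)))

  related : ∀ κ {s} → proj₁ (image κ) ≡ s → R (suc (toℕ κ)) s
  related κ refl = proj₂ (proj₂ (image κ))

  imageᶠ-injective : ∀ {κ κ′} → imageᶠ κ ≡ imageᶠ κ′ → κ ≡ κ′
  imageᶠ-injective {κ} {κ′} e = toℕ-injective (suc-injective (injective
    (related κ (trans (sym (toℕ-fromℕ< _)) (trans (cong toℕ e) (toℕ-fromℕ< _)))) (related κ′ refl)))

  hit : ∀ s → s < N → ∃ λ κ → proj₁ (image κ) ≡ s
  hit s h with injective⇒surjective imageᶠ imageᶠ-injective (fromℕ< h)
  ... | κ , e = κ , trans (sym (toℕ-fromℕ< _)) (trans (cong toℕ e) (toℕ-fromℕ< _))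

  surjective : ∀ s → s < N → ∃ λ k → R k s
  surjective s h = let κ , e = hit s h in suc (toℕ κ) , related κ e

  functional : ∀ {k s s′} → s < N → s′ < N → R k s → R k s′ → s ≡ s′
  functional h h′ r r′ =
    let κ , e = hit _ h
        κ′ , e′ = hit _ h′
        κ≡κ′ = toℕ-injective (suc-injective (trans (injective (related κ e) r) (sym (injective (related κ′ e′) r′))))
    in trans (sym e) (trans (cong (λ κ → proj₁ (image κ)) κ≡κ′) e′)

-- This lets an argument by contradiction produce an explicit solution.
rainbow? : ∀ m n c → Dec (RainbowSolution m n c)
rainbow? m n c with anyUpTo? (λ a₁ → anyUpTo? (λ a₂ → anyUpTo? (λ b₁ → anyUpTo? (λ b₂ → body? a₁ a₂ b₁ b₂)
                      (suc n)) (suc m)) (suc n)) (suc m)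
  where
  inGrid? : ∀ i j → Dec (InGrid m n i j)
  inGrid? i j = ((1 ≤? i) ×-dec (i ≤? m)) ×-dec ((1 ≤? j) ×-dec (j ≤? n))
  body? : ∀ a₁ a₂ b₁ b₂ → Dec
    (InGrid m n a₁ a₂ × InGrid m n b₁ b₂ × InGrid m n (a₁ + b₁) (a₂ + b₂) ×
     c a₁ a₂ ≢ c b₁ b₂ × c a₁ a₂ ≢ c (a₁ + b₁) (a₂ + b₂) × c b₁ b₂ ≢ c (a₁ + b₁) (a₂ + b₂))
  body? a₁ a₂ b₁ b₂ = inGrid? a₁ a₂ ×-dec (inGrid? b₁ b₂ ×-dec (inGrid? (a₁ + b₁) (a₂ + b₂) ×-dec
    (¬? (_ ≟ _) ×-dec (¬? (_ ≟ _) ×-dec ¬? (_ ≟ _)))))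
... | yes (a₁ , _ , a₂ , _ , b₁ , _ , b₂ , _ , body) = yes (a₁ , a₂ , b₁ , b₂ , body)
... | no none = no λ (a₁ , a₂ , b₁ , b₂ , body@(((_ , ha₁) , (_ , ha₂)) , ((_ , hb₁) , (_ , hb₂)) , _)) →
      none (a₁ , s≤s ha₁ , a₂ , s≤s ha₂ , b₁ , s≤s hb₁ , b₂ , s≤s hb₂ , body)

noRainbow : ∀ {m n c} → ¬ RainbowSolution m n c → NoRainbow m n c
noRainbow {m} {n} {c} ¬R a₁ a₂ b₁ b₂ refl refl p₁ p₂ q₁ q₂ h₁ h₂
  with c a₁ a₂ ≟ c b₁ b₂ | c a₁ a₂ ≟ c (a₁ + b₁) (a₂ + b₂) | c b₁ b₂ ≟ c (a₁ + b₁) (a₂ + b₂)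
... | yes e | _ | _ = inj₁ e
... | no _ | yes e | _ = inj₂ (inj₁ e)
... | no _ | no _ | yes e = inj₂ (inj₂ e)
... | no x | no y | no z = ⊥-elim (¬R (a₁ , a₂ , b₁ , b₂ ,
      ((p₁ , m+n≤o⇒m≤o a₁ h₁) , (p₂ , m+n≤o⇒m≤o a₂ h₂)) ,
      ((q₁ , m+n≤o⇒n≤o a₁ h₁) , (q₂ , m+n≤o⇒n≤o a₂ h₂)) ,
      ((≤-trans p₁ (m≤m+n a₁ b₁) , h₁) , (≤-trans p₂ (m≤m+n a₂ b₂) , h₂)) , x , y , z))

-- Counting colours against diagonals.

-- The default 0 is not a colour, since colours start at 1.
at : List ℕ → ℕ → ℕ
at [] _ = 0
at (x ∷ xs) zero = x
at (x ∷ xs) (suc e) = at xs e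

∈⇒at : ∀ {k xs} → k ∈ xs → ∃ λ e → e < length xs × at xs e ≡ k
∈⇒at (here e) = 0 , 1≤suc , sym e
∈⇒at (there p) = let e , h , q = ∈⇒at p in suc e , s≤s h , q

module Tightness {m n : ℕ} {c : Coloring} (nr : NoRainbow m n c) (1≤m : 1 ≤ m) (m≤n : m ≤ n)
                 (exact : IsExactColoring m n (m + n + 1) c) (diag : DiagColorsAtMost m c 3) where

  OnMain : ℕ → Set
  OnMain k = ∃ λ t → t < m × c (suc t) (suc t) ≡ k

  onMain? : ∀ k → Dec (OnMain k)
  onMain? k = anyUpTo? (λ t → c (suc t) (suc t) ≟ k) m

  onMain : ∀ {k} i → 1 ≤ i → i ≤ m → c i i ≡ k → OnMain k
  onMain (suc t) _ h e = t , h , e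

  1≤n : 1 ≤ n
  1≤n = ≤-trans 1≤m m≤n

  cs : List ℕ
  cs = proj₁ diag

  -- Off the main diagonal the slot of a colour is n + i ∸ j for some point (i , j)
  -- of that colour.  The values n, 0 and m + n are then free, and they are the
  -- slots of the three colours on the main diagonal.
  code : ℕ → ℕ
  code zero = n
  code (suc zero) = 0
  code (suc (suc _)) = m + n

  code≤ : ∀ e → code e ≤ m + n
  code≤ zero = m≤n+m n m
  code≤ (suc zero) = z≤n
  code≤ (suc (suc _)) = ≤-refl

  code-injective : ∀ {e e′} → e < 3 → e′ < 3 → code e ≡ code e′ → e ≡ e′
  code-injective {0} {0} _ _ _ = refl
  code-injective {1} {1} _ _ _ = refl
  code-injective {2} {2} _ _ _ = refl
  code-injective {0} {1} _ _ q = ⊥-elim (<⇒≢ 1≤n (sym q))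
  code-injective {1} {0} _ _ q = ⊥-elim (<⇒≢ 1≤n q)
  code-injective {0} {2} _ _ q = ⊥-elim (<⇒≢ (m<n+m n 1≤m) q)
  code-injective {2} {0} _ _ q = ⊥-elim (<⇒≢ (m<n+m n 1≤m) (sym q))
  code-injective {1} {2} _ _ q = ⊥-elim (<⇒≢ (≤-trans 1≤m (m≤m+n m n)) q)
  code-injective {2} {1} _ _ q = ⊥-elim (<⇒≢ (≤-trans 1≤m (m≤m+n m n)) (sym q))
  code-injective {suc (suc (suc _))} (s≤s (s≤s (s≤s ()))) _ _
  code-injective {0} {suc (suc (suc _))} _ (s≤s (s≤s (s≤s ()))) _
  code-injective {1} {suc (suc (suc _))} _ (s≤s (s≤s (s≤s ()))) _
  code-injective {2} {suc (suc (suc _))} _ (s≤s (s≤s (s≤s ()))) _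

  -- A colour not on the main diagonal gets a slot from each diagonal that it meets; the count will
  -- leave it only one.
  data Slot (k s : ℕ) : Set where
    main : OnMain k → ∀ e → e < 3 → at cs e ≡ k → s ≡ code e → Slot k s
    side : ¬ OnMain k → ∀ i j → InGrid m n i j → c i j ≡ k → s + j ≡ n + i → Slot k s

  slot : ∀ k → 1 ≤ k → k ≤ m + n + 1 → ∃ λ s → s < m + n + 1 × Slot k s
  slot k 1≤k k≤ with onMain? k
  ... | yes (t , t<m , refl) with ∈⇒at (proj₂ (proj₂ diag) (suc t) 1≤suc t<m)
  ...   | e , e< , q = code e , ≤-trans (s≤s (code≤ e)) (≤-reflexive (+-comm 1 (m + n))) ,
            main (t , t<m , refl) e (≤-trans e< (proj₁ (proj₂ diag))) q refl
  slot k 1≤k k≤ | no ¬M with proj₂ exact k 1≤k k≤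
  ... | i , j , g@((1≤i , i≤m) , (1≤j , j≤n)) , e with ≤⇒≡+ (≤-trans j≤n (m≤m+n n i))
  ...   | s , q = s , ≤-by 1 (1≤j ⊹ ≤-reflexive (sym q) ⊹ i≤m) (solve (m ∷ n ∷ s ∷ i ∷ j ∷ [])) ,
            side ¬M i j g e (trans (+-comm s j) (sym q))

  -- The difference `(suc t , suc t)` has a colour of the main diagonal, so it agrees with neither
  -- point.
  side-colour-above : ∀ i j t i′ j′ → i + suc t ≡ i′ → j + suc t ≡ j′ → InGrid m n i j → InGrid m n i′ j′ →
    ¬ OnMain (c i j) → ¬ OnMain (c i′ j′) → c i j ≡ c i′ j′
  side-colour-above i j t i′ j′ e e′ ((1≤i , _) , (1≤j , _)) ((_ , hi) , (_ , hj)) ¬M ¬M′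
    with nr i j (suc t) (suc t) e e′ 1≤i 1≤j 1≤suc 1≤suc hi hj
  ... | inj₁ q = ⊥-elim (¬M (onMain (suc t) 1≤suc (≤-trans (≤-trans (m≤n+m (suc t) i) (≤-reflexive e)) hi) (sym q)))
  ... | inj₂ (inj₁ q) = q
  ... | inj₂ (inj₂ q) = ⊥-elim (¬M′ (onMain (suc t) 1≤suc (≤-trans (≤-trans (m≤n+m (suc t) i) (≤-reflexive e)) hi) q))

  side-colour : ∀ s i j i′ j′ → s + j ≡ n + i → s + j′ ≡ n + i′ → InGrid m n i j → InGrid m n i′ j′ →
    ¬ OnMain (c i j) → ¬ OnMain (c i′ j′) → c i j ≡ c i′ j′
  side-colour s i j i′ j′ e e′ g g′ ¬M ¬M′ with <-cmp i i′
  ... | tri≈ _ refl _ = cong (c i) (+-cancelˡ-≡ s j j′ (trans e (sym e′)))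
  ... | tri< i<i′ _ _ with ≤⇒≡+ i<i′
  ...   | t , refl = side-colour-above i j t i′ j′ (+-suc i t)
            (≡-by (cong₂ _+_ e (sym e′)) (solve (s ∷ j ∷ j′ ∷ n ∷ i ∷ t ∷ []))) g g′ ¬M ¬M′
  side-colour s i j i′ j′ e e′ g g′ ¬M ¬M′ | tri> _ _ i′<i with ≤⇒≡+ i′<i
  ...   | t , refl = sym (side-colour-above i′ j′ t i j (+-suc i′ t)
            (≡-by (cong₂ _+_ e′ (sym e)) (solve (s ∷ j ∷ j′ ∷ n ∷ i′ ∷ t ∷ []))) g′ g ¬M′ ¬M)

  -- Slot `n` would mean `i = j`, slot 0 would mean `j > n`, and slot `m + n` would mean `i > m`.
  side≢code : ∀ e i j → InGrid m n i j → ¬ OnMain (c i j) → code e + j ≢ n + i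
  side≢code zero i j ((1≤i , i≤m) , _) ¬M q with +-cancelˡ-≡ n j i q
  ... | refl = ¬M (onMain i 1≤i i≤m refl)
  side≢code (suc zero) i j ((1≤i , _) , (_ , j≤n)) _ q =
    ⊥-by 0 (1≤i ⊹ j≤n ⊹ ≤-reflexive {y = j} (sym q)) (solve (n ∷ i ∷ j ∷ []))
  side≢code (suc (suc _)) i j ((_ , i≤m) , (1≤j , _)) _ q =
    ⊥-by 0 (i≤m ⊹ 1≤j ⊹ ≤-reflexive {m + n + j} q) (solve (m ∷ n ∷ i ∷ j ∷ []))

  slot-injective : ∀ {k k′ s} → Slot k s → Slot k′ s → k ≡ k′
  slot-injective (main _ e h q refl) (main _ e′ h′ q′ r) =
    trans (sym q) (trans (cong (at cs) (code-injective h h′ r)) q′)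
  slot-injective (main _ e _ _ refl) (side ¬M i j g refl r) = ⊥-elim (side≢code e i j g ¬M r)
  slot-injective (side ¬M i j g refl r) (main _ e _ _ refl) = ⊥-elim (side≢code e i j g ¬M r)
  slot-injective {s = s} (side ¬M i j g refl r) (side ¬M′ i′ j′ g′ refl r′) = side-colour s i j i′ j′ r r′ g g′ ¬M ¬M′

  filled : ∀ s → s ≤ m + n → ∃ λ k → Slot k s
  filled s h = Pigeonhole.surjective slot slot-injective s (≤-trans (s≤s h) (≤-reflexive (+-comm 1 (m + n))))

  slots-agree : ∀ {k s s′} → s ≤ m + n → s′ ≤ m + n → Slot k s → Slot k s′ → s ≡ s′
  slots-agree h h′ = Pigeonhole.functional slot slot-injective
    (≤-trans (s≤s h) (≤-reflexive (+-comm 1 (m + n)))) (≤-trans (s≤s h′) (≤-reflexive (+-comm 1 (m + n))))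

  -- Only a colour off the main diagonal can fill `s`, and a second diagonal with that colour would
  -- give it a second slot.
  special-exists : ∀ s → 1 ≤ s → s < m + n → s ≢ n → ∃ λ i → ∃ λ j → Special m n c i j × s + j ≡ n + i
  special-exists s 1≤s s< s≢n = go (filled s (<⇒≤ s<))
    where
    go : ∃ (λ k → Slot k s) → ∃ λ i → ∃ λ j → Special m n c i j × s + j ≡ n + i
    go (k , main _ zero _ _ e) = ⊥-elim (s≢n e)
    go (k , main _ (suc zero) _ _ e) = ⊥-elim (<⇒≢ 1≤s (sym e))
    go (k , main _ (suc (suc _)) _ _ e) = ⊥-elim (<⇒≢ s< e)
    go (k , S@(side ¬M i j g refl r)) = i , j , special g
        (λ { refl → s≢n (+-cancelʳ-≡ i s n r) })
        (λ i′ j′ g′ e′ → own i′ j′ g′ e′ (≤⇒≡+ (≤-trans (proj₂ (proj₂ g′)) (m≤m+n n i′)))) , r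
      where
      own : ∀ i′ j′ → InGrid m n i′ j′ → c i′ j′ ≡ c i j → (∃ λ s′ → n + i′ ≡ j′ + s′) → i′ + j ≡ i + j′
      own i′ j′ g′@((_ , i′≤m) , (1≤j′ , _)) e′ (s′ , q) =
        ≡-by (cong₂ _+_ r (trans q (cong (j′ +_) (sym s≡s′)))) (solve (n ∷ s ∷ i ∷ j ∷ i′ ∷ j′ ∷ []))
        where
        s′≤ : s′ ≤ m + n
        s′≤ = ≤-by 1 (i′≤m ⊹ 1≤j′ ⊹ ≤-reflexive (sym q)) (solve (m ∷ n ∷ i′ ∷ j′ ∷ s′ ∷ []))
        s≡s′ : s ≡ s′
        s≡s′ = slots-agree (<⇒≤ s<) s′≤ S (side ¬M i′ j′ g′ e′ (trans (+-comm s′ j′) (sym q)))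

  -- By `side≢code` only the main diagonal can supply a colour for a reserved slot.
  main-filled : ∀ e → ∃ λ t → t < m × Slot (c (suc t) (suc t)) (code e)
  main-filled e = go (filled (code e) (code≤ e))
    where
    go : ∃ (λ k → Slot k (code e)) → ∃ λ t → t < m × Slot (c (suc t) (suc t)) (code e)
    go (k , S@(main (t , t<m , refl) _ _ _ _)) = t , t<m , S
    go (k , side ¬M i j g refl r) = ⊥-elim (side≢code e i j g ¬M r)

  main-distinct : ∀ {e e′ k k′} → e < 3 → e′ < 3 → e ≢ e′ → Slot k (code e) → Slot k′ (code e′) → k ≢ k′
  main-distinct {e} {e′} h h′ e≢ S S′ refl = e≢ (code-injective h h′ (slots-agree (code≤ e) (code≤ e′) S S′))

  palette : ∃ λ b → ∃ λ g → Palette c m b g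
  palette = go (main-filled 0) (main-filled 1) (main-filled 2)
    where
    OfSlot : ℕ → Set
    OfSlot e = ∃ λ t → t < m × Slot (c (suc t) (suc t)) (code e)
    go : OfSlot 0 → OfSlot 1 → OfSlot 2 → ∃ λ b → ∃ λ g → Palette c m b g
    go (t₀ , h₀ , S₀) (t₁ , h₁ , S₁) (t₂ , h₂ , S₂) =
      palette-exists (suc t₀) (suc t₁) (suc t₂) 1≤suc h₀ 1≤suc h₁ 1≤suc h₂
        (main-distinct 1≤suc (s≤s 1≤suc) (λ ()) S₀ S₁)
        (main-distinct 1≤suc (s≤s (s≤s 1≤suc)) (λ ()) S₀ S₂)
        (main-distinct (s≤s 1≤suc) (s≤s (s≤s 1≤suc)) (λ ()) S₁ S₂)

  low : ∀ d → 1 ≤ d → d < m → ∃ (First m n c d)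
  low d 1≤d d<m = go (special-exists (n + d) (≤-trans 1≤d (m≤n+m d n))
      (≤-trans (s≤s (≤-reflexive (+-comm n d))) (+-monoˡ-≤ n d<m)) (λ e → <⇒≢ (m<m+n n 1≤d) (sym e)))
    where
    go : (∃ λ i → ∃ λ j → Special m n c i j × n + d + j ≡ n + i) → ∃ (First m n c d)
    go (i , j , S , r) = first-exists nr d j 1≤d
      (subst (λ t → Special m n c t j) (sym (+-cancelˡ-≡ n (d + j) i (trans (sym (+-assoc n d j)) r))) S)

  high : ∀ d → 1 ≤ d → d < n → ∃ (First n m (flip c) d)
  high d 1≤d d<n = from-offset (≤⇒≡+ d<n)
    where
    from-offset : ∃ (λ s → n ≡ suc d + s) → ∃ (First n m (flip c) d)
    -- `suc s` is `n - d`, the slot of offset `-d`.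
    from-offset (s , e) = go (special-exists (suc s) 1≤suc s<m+n s≢n)
      where
      s<m+n : suc s < m + n
      s<m+n = ≤-by d (≤-reflexive (sym e) ⊹ 1≤m) (solve (m ∷ n ∷ d ∷ s ∷ []))
      s≢n : suc s ≢ n
      s≢n q = <⇒≢ 1≤d (sym (+-cancelʳ-≡ (suc s) d 0 (trans (+-suc d s) (trans (sym e) (sym q)))))
      go : (∃ λ i → ∃ λ j → Special m n c i j × suc s + j ≡ n + i) → ∃ (First n m (flip c) d)
      go (i , j , S , r) = first-exists (noRainbow-flip nr) d i 1≤d
        (subst (λ t → Special n m (flip c) t i) j≡d+i (special-flip S))
        where
        j≡d+i : j ≡ d + i
        j≡d+i = ≡-by (cong₂ _+_ r e) (solve (n ∷ d ∷ s ∷ i ∷ j ∷ []))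

theorem3p4 : (m n : ℕ) → 3 ≤ m → m ≤ n → (c : ℕ → ℕ → ℕ) →
    IsExactColoring m n (m + n + 1) c → DiagColorsAtMost m c 3 →
    RainbowSolution m n c
theorem3p4 m n 3≤m m≤n c exact diag with rainbow? m n c
... | yes R = R
... | no ¬R = ⊥-elim (three-coloured-diagonal-impossible nr (proj₂ (proj₂ T.palette)) ≤-refl m≤n T.low T.high)
  where
  nr = noRainbow ¬R
  module T = Tightness nr (≤-trans (s≤s z≤n) 3≤m) m≤n exact diag
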